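{- Let $(E,\mathcal{I},g)$ be any CBGT instance where $(E,\mathcal{I})$ is a $k$-uniform matroid, i.e. $\mathcal{I}=\{X\subseteq E : |X|\le k\}$. Then the Fuse–Unfuse Scheduling Algorithm, given $E$, $k$ and $g$, implements in polynomial time an infinite valid schedule $\pi$ for $(E,\mathcal{I},g)$ of height at most $2$, i.e. $h(\pi)\le 2$.
   Context: An instance of Combinatorial Bamboo Garden Trimming (CBGT) is a triple $(E,\mathcal{I},g)$ where $E$ is a finite set (of "bamboos"), $\mathcal{I}\subseteq 2^E$ is a family of subsets of $E$, and $g\in\mathbb{Q}_{\ge 0}^E$ is a vector of growth rates such that there are coefficients $\lambda(I)\ge 0$ ($I\in\mathcal{I}$) with $\sum_{I\in\mathcal{I}}\lambda(I)=1$ and $g(e)=\sum_{I\in\mathcal{I}:\, e\in I}\lambda(I)$ for every $e\in E$. Let $\mathbb{N}=\{1,2,\dots\}$. An infinite schedule is a sequence $\pi=\pi(1),\pi(2),\dots$ of subsets of $E$; it is valid if $\pi(t)\in\mathcal{I}$ for all $t\in\mathbb{N}$. $h^\pi_t(e)$ denotes the height of $e$ on day $t$ after growing but before $\pi(t)$ is cut, i.e. $h^\pi_1(e)=g(e)$, and $h^\pi_{t+1}(e)=g(e)$ if $e\in\pi(t)$, $h^\pi_{t+1}(e)=h^\pi_t(e)+g(e)$ otherwise. The height of $\pi$ is $h(\pi)=\max_{e\in E}\sup_{t\in\mathbb{N}}h^\pi_t(e)$. An algorithm implements $\pi$ if it outputs $\pi(1),\pi(2),\dots$ one step at a time; polynomial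 time means that preprocessing and the computation of each next set take time polynomial in the input size. Fuse–Unfuse Scheduling Algorithm. Input: $E$, $k$, $g$ with $|E|\ge k$ and $g(e)>0$ for all $e$ (if not, first delete all elements with $g(e)=0$, which never need to be cut, and if then $k>|E|$ replace $k$ by $|E|$). Preprocessing: start with the collection $H$ of one-vertex trees, one for each $e\in E$, with growth rate $g(e)$. While $|H|>k$: remove from $H$ two trees $T_L,T_R$ of minimum growth rate (ties broken arbitrarily) and insert a new binary tree $T$ whose root has left child $T_L$ and right child $T_R$, with growth rate $g(T)=2\max\{g(T_L),g(T_R)\}$. Let $T_1,\dots,T_k$ be the remaining trees; give each internal vertex $v$ a bit $\sigma(v)=0$. Execution on each day: for each $i=1,\dots,k$, start at the root of $T_i$ and, while the current vertex $v$ is not a leaf, flip $\sigma(v)$ and move to the left child of $v$ if now $\sigma(v)=0$ and to the right child if now $\sigma(v)=1$. The set cut on that day consists of the $k$ leaves (elements of $E$) reached. -}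

module Defs where

open import Data.Bool using (Bool; true; false; not; if_then_else_)
open import Data.Fin using (Fin)
open import Data.Fin.Subset using (Subset; inside; outside; ⁅_⁆; ⋃; ∣_∣)
open import Data.Fin.Subset.Properties using (_∈?_)
open import Data.Integer using (+_) renaming (∣_∣ to absℤ)
open import Data.List using (List; []; _∷_; _++_; map; filter; foldr; length; allFin)
open import Data.Nat using (ℕ; zero; suc; _+_; _*_; _⊓_; _≤_; _≤?_)
open import Data.Nat.ListAction using (sum)
open import Data.Nat.Logarithm using (⌊log₂_⌋)
open import Data.Product using (_×_; _,_; proj₁; proj₂)
open import Data.Rational as ℚ using (ℚ; 0ℚ; 1ℚ; _⊔_; ↥_; ↧ₙ_)
import Data.Rational.Properties as ℚₚ
open import Data.Unit using (⊤; tt)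
open import Data.Vec as Vec using (Vec; []; _∷_)
open import Function using (_∘_)
open import Level using (0ℓ)
open import Relation.Binary.Definitions using (Tri; tri<; tri≈; tri>)
open import Relation.Binary.PropositionalEquality using (_≡_)
open import Relation.Nullary using (yes; no; does)
open import Relation.Unary using (Pred; Decidable)

------------------------------------------------------------------------
-- Instances.  The ground set E is Fin n.

sumℚ : List ℚ → ℚ
sumℚ = foldr ℚ._+_ 0ℚ

subsets : ∀ n → List (Subset n)
subsets zero    = [] ∷ []
subsets (suc n) = map (outside ∷_) (subsets n) ++ map (inside ∷_) (subsets n)

record Family (n : ℕ) : Set₁ where
  field
    Member  : Pred (Subset n) 0ℓ
    member? : Decidable Member

  members : List (Subset n)
  members = filter member? (subsets n)

  membersContaining : Fin n → List (Subset n)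
  membersContaining e = filter (e ∈?_) members

open Family public

-- The coefficients are taken rational.  The conditions on them form a
-- finite linear system with rational data, so a real solution exists
-- exactly when a rational one does.
record IsCBGT {n : ℕ} (𝓘 : Family n) (g : Fin n → ℚ) : Set where
  field
    g-nonNegative : ∀ e → 0ℚ ℚ.≤ g e
    coeff         : Subset n → ℚ
    c-nonNegative : ∀ I → Member 𝓘 I → 0ℚ ℚ.≤ coeff I
    c-sum         : sumℚ (map coeff (members 𝓘)) ≡ 1ℚ
    c-growth      : ∀ e → g e ≡ sumℚ (map coeff (membersContaining 𝓘 e))

uniformMatroid : ∀ n → ℕ → Family n
uniformMatroid n k = record
  { Member  = λ X → ∣ X ∣ ≤ k
  ; member? = λ X → ∣ X ∣ ≤? k
  }

------------------------------------------------------------------------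
-- Schedules.  Days are numbered from 0: π t is the set written π(t+1)
-- when days are numbered from 1, and likewise for heights.

Schedule : ℕ → Set
Schedule n = ℕ → Subset n

Valid : ∀ {n} → Family n → Schedule n → Set
Valid 𝓘 π = ∀ t → Member 𝓘 (π t)

height : ∀ {n} → (Fin n → ℚ) → Schedule n → ℕ → Fin n → ℚ
height g π zero    e = g e
height g π (suc t) e with e ∈? π t
... | yes _ = g e
... | no  _ = height g π t e ℚ.+ g e

-- max_e sup_t h_t(e) ≤ b.  The supremum itself need not be computable,
-- but it is at most b precisely when b is an upper bound.
HeightAtMost : ∀ {n} → (Fin n → ℚ) → Schedule n → ℚ → Set
HeightAtMost g π b = ∀ e t → height g π t e ℚ.≤ b

------------------------------------------------------------------------
-- Terminating nondeterministic computations with a running time.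
-- step s c spends s time units; c ⊕ d makes an arbitrary choice.

infixr 4 _⊕_
infixl 1 _>>=_ _>>_

data Comp (A : Set) : Set where
  return : A → Comp A
  step   : ℕ → Comp A → Comp A
  _⊕_    : Comp A → Comp A → Comp A

_>>=_ : ∀ {A B} → Comp A → (A → Comp B) → Comp B
return a >>= f = f a
step s c >>= f = step s (c >>= f)
(c ⊕ d)  >>= f = (c >>= f) ⊕ (d >>= f)

_>>_ : ∀ {A B} → Comp A → Comp B → Comp B
c >> d = c >>= λ _ → d

charge : ℕ → Comp ⊤
charge s = step s (return tt)

-- c ⇓ a [ t ]: some resolution of the choices in c yields a in time t.
data _⇓_[_] {A : Set} : Comp A → A → ℕ → Set where
  ⇓-return : ∀ {a} → return a ⇓ a [ 0 ]
  ⇓-step   : ∀ {s c a t} → c ⇓ a [ t ] → step s c ⇓ a [ s + t ]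
  ⇓-left   : ∀ {c d a t} → c ⇓ a [ t ] → (c ⊕ d) ⇓ a [ t ]
  ⇓-right  : ∀ {c d a t} → d ⇓ a [ t ] → (c ⊕ d) ⇓ a [ t ]

------------------------------------------------------------------------
-- Cost model: a logarithmic-cost pointer machine.  Numbers are written
-- in binary.  Handling a pointer, a bit, an element label or one cell
-- of a list takes one unit; arithmetic is charged by bit length.

bits : ℕ → ℕ
bits m = suc ⌊log₂ m ⌋

size : ℚ → ℕ
size q = bits (absℤ (↥ q)) + bits (↧ₙ q)

-- Comparison by schoolbook cross multiplication.
compareCost : ℚ → ℚ → ℕ
compareCost p q = (size p + size q) * (size p + size q)

-- Doubling p/q in lowest terms gives (2p)/q or p/(q/2), a bit shift.
doubleCost : ℚ → ℕ
doubleCost q = size q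

inputSize : ∀ n → ℕ → (Fin n → ℚ) → ℕ
inputSize n k g = n + bits k + sum (map (size ∘ g) (allFin n))

------------------------------------------------------------------------
-- The Fuse–Unfuse Scheduling Algorithm

data Tree (n : ℕ) : Set where
  leaf : Fin n → Tree n
  node : (σ : Bool) (l r : Tree n) → Tree n

-- A tree together with its growth rate.
Rated : ℕ → Set
Rated n = ℚ × Tree n

-- One-vertex trees for the listed elements of nonzero growth rate.
singletons : ∀ {n} → (Fin n → ℚ) → List (Fin n) → Comp (List (Rated n))
singletons g []       = charge 1 >> return []
singletons g (e ∷ es) = do
  charge (1 + size (g e))
  H ← singletons g es
  return (keep H)
  where
  keep : List (Rated _) → List (Rated _)
  keep H with g e ℚₚ.≟ 0ℚ
  ... | yes _ = H
  ... | no  _ = (g e , leaf e) ∷ H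

-- Remove a tree of minimum growth rate.  The choice made on equal rates
-- is free, so every tree of minimum rate is a possible outcome.
extractMin : ∀ {n m} → Vec (Rated n) (suc m) → Comp (Rated n × Vec (Rated n) m)
extractMin         (x ∷ [])     = charge 1 >> return (x , [])
extractMin {n} {suc m} (x ∷ y ∷ ys) = do
  (z , zs) ← extractMin (y ∷ ys)
  charge (1 + compareCost (proj₁ x) (proj₁ z))
  select z zs (ℚₚ.<-cmp (proj₁ x) (proj₁ z))
  where
  select : (z : Rated n) → Vec (Rated n) m →
           Tri (proj₁ x ℚ.< proj₁ z) (proj₁ x ≡ proj₁ z) (proj₁ z ℚ.< proj₁ x) →
           Comp (Rated n × Vec (Rated n) (suc m))
  select z zs (tri< _ _ _) = return (x , z ∷ zs)
  select z zs (tri≈ _ _ _) = return (x , z ∷ zs) ⊕ return (z , x ∷ zs)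
  select z zs (tri> _ _ _) = return (z , x ∷ zs)

2ℚ : ℚ
2ℚ = + 2 ℚ./ 1

fuse : ∀ {n} → Rated n → Rated n → Comp (Rated n)
fuse (a , L) (b , R) = do
  charge (1 + compareCost a b + doubleCost (a ⊔ b))
  return (2ℚ ℚ.* (a ⊔ b) , node false L R)

-- Either of the two trees of minimum rate may become the left child.
fuseRound : ∀ {n m} → Vec (Rated n) (suc (suc m)) → Comp (Vec (Rated n) (suc m))
fuseRound H = do
  (S , H₁) ← extractMin H
  (T , H₂) ← extractMin H₁
  U ← fuse S T ⊕ fuse T S
  return (U ∷ H₂)

-- While |H| > k, fuse.  The index m is |H|.  If k = 0 and a single tree
-- is left, there is nothing to fuse it with and the loop stops.
fuseLoop : ∀ {n} → ℕ → ∀ m → Vec (Rated n) m → Comp (List (Rated n))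
fuseLoop k zero          H = charge 1 >> return []
fuseLoop k (suc zero)    H = charge 1 >> return (Vec.toList H)
fuseLoop k (suc (suc m)) H = do
  charge (suc (suc m) + bits k)
  if does (suc (suc m) ≤? k)
    then return (Vec.toList H)
    else (fuseRound H >>= fuseLoop k (suc m))

preprocess : ∀ {n} → ℕ → (Fin n → ℚ) → Comp (List (Tree n))
preprocess {n} k g = do
  H ← singletons g (allFin n)
  charge (length H + bits k)
  H′ ← fuseLoop (k ⊓ length H) (length H) (Vec.fromList H)
  charge (length H′)
  return (map proj₂ H′)

-- The walk from the root of one tree: the tree with updated bits and the
-- leaf reached.
unfuse : ∀ {n} → Tree n → Comp (Tree n × Fin n)
unfuse (leaf e)     = charge 1 >> return (leaf e , e)
unfuse (node σ l r) = charge 1 >> descend (not σ)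
  where
  descend : Bool → Comp (Tree _ × Fin _)
  descend false = do
    (l′ , e) ← unfuse l
    return (node false l′ r , e)
  descend true = do
    (r′ , e) ← unfuse r
    return (node true l r′ , e)

day : ∀ {n} → List (Tree n) → Comp (List (Tree n) × List (Fin n))
day []       = charge 1 >> return ([] , [])
day (T ∷ Ts) = do
  charge 1
  (T′ , e) ← unfuse T
  (Ts′ , es) ← day Ts
  return (T′ ∷ Ts′ , e ∷ es)

-- An infinite execution, for one way of resolving the choices.
record Run {n : ℕ} (k : ℕ) (g : Fin n → ℚ) : Set where
  field
    forest   : ℕ → List (Tree n)
    output   : ℕ → List (Fin n)
    prepTime : ℕ
    dayTime  : ℕ → ℕ
    prep     : preprocess k g ⇓ forest 0 [ prepTime ]
    days     : ∀ t → day (forest t) ⇓ (forest (suc t) , output t) [ dayTime t ]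

  schedule : Schedule n
  schedule t = ⋃ (map ⁅_⁆ (output t))

open Run public

{-# OPTIONS --safe #-}

-- A leaf at depth d of a tree is cut once every 2^d days, and a fused tree
-- has at least twice the rate of each of its parts, so no bamboo outgrows
-- the rate of its final tree.  It remains to see that this rate is at most
-- 2.  While the trees are fused there is a floor m ≥ 0 below all rates such
-- that the total rate is at most k + m.  When trees of rates a ≤ b are fused, m ≤ a
-- leaves at most k for the trees other than the first.  There are at least
-- k of them, each of rate at least b, so b ≤ 1 and the new rate 2b is at
-- most 2; the total becomes at most k + b, and b is the new floor.
module Submission where

open import Defs
open import Algebra.Bundles using (CommutativeMonoid)
open import Data.Bool using (true; false; if_then_else_)
open import Data.Empty using (⊥-elim)
open import Data.Fin using (Fin; zero; suc)
open import Data.Fin.Subset using (Subset; inside; outside; ⁅_⁆; ⋃; ∣_∣; _∪_; _∈_)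
open import Data.Fin.Subset.Properties using (_∈?_; x∈⁅x⁆; ∣⁅x⁆∣≡1; ∣⊥∣≡0; x∈p∪q⁺)
import Data.Integer as ℤ
import Data.Integer.Properties as ℤₚ
open import Data.List using (List; []; _∷_; map; filter; length; allFin; tabulate)
open import Data.List.Membership.Propositional using () renaming (_∈_ to _∈ˡ_)
open import Data.List.Membership.Propositional.Properties using (∈-filter⁺; ∈-allFin)
open import Data.List.Properties
  using (map-cong; map-∘; map-tabulate; length-map; length-filter; length-tabulate)
open import Data.List.Relation.Binary.Permutation.Propositional
  using (_↭_; swap; ↭-refl; ↭-sym; ↭-trans; ↭-prep; ↭-swap)
open import Data.List.Relation.Binary.Permutation.Propositional.Properties
  using (All-resp-↭; Any-resp-↭; ↭-length) renaming (map⁺ to ↭-map⁺)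
open import Data.List.Relation.Unary.All as All using (All; []; _∷_)
import Data.List.Relation.Unary.All.Properties as Allₚ
open import Data.List.Relation.Unary.Any as Any using (Any; here; there)
import Data.List.Relation.Unary.Any.Properties as Anyₚ
open import Data.Nat as ℕ using (ℕ; zero; suc; _+_; _*_; _^_; _≤_; _⊓_; _≤?_; z≤n; s≤s; NonZero)
open import Data.Nat.ListAction using (sum)
open import Data.Nat.ListAction.Properties using (sum-↭)
open import Data.Nat.Logarithm using (⌊log₂⌋-mono-≤; ⌊log₂[2*b]⌋≡1+⌊log₂b⌋)
import Data.Nat.Properties as ℕₚ
open import Data.Nat.Tactic.RingSolver using (solve-∀)
open import Data.Product using (_×_; _,_; proj₁; proj₂; ∃-syntax)
open import Data.Rational as ℚ using (ℚ; 0ℚ; 1ℚ; _⊔_; ↥_; ↧_; ↧ₙ_)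
import Data.Rational.Properties as ℚₚ
open import Data.Sum using (_⊎_; inj₁; inj₂)
open import Data.Vec as Vec using (Vec; []; _∷_)
open import Data.Vec.Properties using (length-toList; toList∘fromList)
open import Function using (_∘_; id)
open import Relation.Binary.Definitions using (tri<; tri≈; tri>)
open import Relation.Binary.PropositionalEquality
  using (_≡_; _≢_; refl; sym; trans; cong; cong₂; subst; module ≡-Reasoning)
open import Relation.Nullary using (¬_; ¬?; Dec; yes; no; does)

open import Algebra.Properties.Monoid.Mult ℚₚ.+-0-monoid
  using (×-homo-+) renaming (_×_ to _·_)
open import Algebra.Properties.CommutativeMonoid.Mult ℚₚ.+-0-commutativeMonoid
  using () renaming (×-distrib-+ to ·-distrib-+)
open import Algebra.Properties.CommutativeSemigroup
  (CommutativeMonoid.commutativeSemigroup ℚₚ.+-0-commutativeMonoid)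
  using () renaming (interchange to +-interchange)

-- Terminating computations

-- `Comp` is inductive, so always taking the left branch terminates. This is where the existence of
-- a run comes from.
outcome : ∀ {A} (c : Comp A) → ∃[ a ] ∃[ t ] c ⇓ a [ t ]
outcome (return a) = a , 0 , ⇓-return
outcome (step s c) = let a , t , p = outcome c in a , s + t , ⇓-step p
outcome (c ⊕ d)    = let a , t , p = outcome c in a , t , ⇓-left p

-- A Hoare triple with a time bound, quantified over every resolution of the choices. It is a
-- record, not a function type, so that `c`, `T` and `P` can be inferred from it.
record Triple {A : Set} (c : Comp A) (T : ℕ) (P : A → Set) : Set where
  field run : ∀ {a t} → c ⇓ a [ t ] → t ≤ T × P a
open Triple

>>=-split : ∀ {A B} {f : A → Comp B} {b t} (c : Comp A) → (c >>= f) ⇓ b [ t ] →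
            ∃[ a ] ∃[ t₁ ] ∃[ t₂ ] (c ⇓ a [ t₁ ] × f a ⇓ b [ t₂ ] × t ≡ t₁ + t₂)
>>=-split (return a) d = a , 0 , _ , ⇓-return , d , refl
>>=-split (step s c) (⇓-step d) =
  let a , t₁ , t₂ , d₁ , d₂ , eq = >>=-split c d in
  a , s + t₁ , t₂ , ⇓-step d₁ , d₂ , trans (cong (s +_) eq) (sym (ℕₚ.+-assoc s t₁ t₂))
>>=-split (c ⊕ _) (⇓-left d) =
  let a , t₁ , t₂ , d₁ , d₂ , eq = >>=-split c d in a , t₁ , t₂ , ⇓-left d₁ , d₂ , eq
>>=-split (_ ⊕ c) (⇓-right d) =
  let a , t₁ , t₂ , d₁ , d₂ , eq = >>=-split c d in a , t₁ , t₂ , ⇓-right d₁ , d₂ , eq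

module _ {A : Set} {P : A → Set} where

  ret : ∀ {a T} → P a → Triple (return a) T P
  ret p .run ⇓-return = z≤n , p

  spend : ∀ s {c T} → Triple c T P → Triple (step s c) (s + T) P
  spend s h .run (⇓-step d) = let q , p = h .run d in ℕₚ.+-monoʳ-≤ s q , p

  choose : ∀ {c d T} → Triple c T P → Triple d T P → Triple (c ⊕ d) T P
  choose h₁ h₂ .run (⇓-left d)  = h₁ .run d
  choose h₁ h₂ .run (⇓-right d) = h₂ .run d

  relax : ∀ {c T U} → T ≤ U → Triple c T P → Triple c U P
  relax T≤U h .run d = let q , p = h .run d in ℕₚ.≤-trans q T≤U , p

  branch : ∀ {Q : Set} (q? : Dec Q) {c d T} → (Q → Triple c T P) → (¬ Q → Triple d T P) →
           Triple (if does q? then c else d) T P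
  branch (yes q) hc _  = hc q
  branch (no ¬q) _  hd = hd ¬q

  bind : ∀ {B : Set} {c : Comp A} {f : A → Comp B} {T U} {Q : B → Set} →
         Triple c T P → (∀ a → P a → Triple (f a) U Q) → Triple (c >>= f) (T + U) Q
  bind {c = c} hc hf .run d with >>=-split c d
  ... | a , _ , _ , d₁ , d₂ , refl =
    let q₁ , p = hc .run d₁ ; q₂ , r = hf a p .run d₂ in ℕₚ.+-mono-≤ q₁ q₂ , r

-- Rational sums

sumℚ-↭ : ∀ {xs ys} → xs ↭ ys → sumℚ xs ≡ sumℚ ys
sumℚ-↭ _↭_.refl = refl
sumℚ-↭ (_↭_.prep x p) = cong (x ℚ.+_) (sumℚ-↭ p)
sumℚ-↭ (swap {xs} {ys} x y p) = begin
  x ℚ.+ (y ℚ.+ sumℚ xs)  ≡⟨ ℚₚ.+-assoc x y _ ⟨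
  x ℚ.+ y ℚ.+ sumℚ xs    ≡⟨ cong₂ ℚ._+_ (ℚₚ.+-comm x y) (sumℚ-↭ p) ⟩
  y ℚ.+ x ℚ.+ sumℚ ys    ≡⟨ ℚₚ.+-assoc y x _ ⟩
  y ℚ.+ (x ℚ.+ sumℚ ys)  ∎
  where open ≡-Reasoning
sumℚ-↭ (_↭_.trans p q) = trans (sumℚ-↭ p) (sumℚ-↭ q)

·-monoʳ-≤ : ∀ n {x y} → x ℚ.≤ y → n · x ℚ.≤ n · y
·-monoʳ-≤ zero    _   = ℚₚ.≤-refl
·-monoʳ-≤ (suc n) x≤y = ℚₚ.+-mono-≤ x≤y (·-monoʳ-≤ n x≤y)

·-zeroʳ : ∀ n → n · 0ℚ ≡ 0ℚ
·-zeroʳ zero    = refl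
·-zeroʳ (suc n) = trans (ℚₚ.+-identityˡ _) (·-zeroʳ n)

0≤· : ∀ n {x} → 0ℚ ℚ.≤ x → 0ℚ ℚ.≤ n · x
0≤· n {x} 0≤x = subst (ℚ._≤ n · x) (·-zeroʳ n) (·-monoʳ-≤ n 0≤x)

·-monoˡ-≤ : ∀ {m n x} → m ≤ n → 0ℚ ℚ.≤ x → m · x ℚ.≤ n · x
·-monoˡ-≤ {n = n} z≤n 0≤x = 0≤· n 0≤x
·-monoˡ-≤ {x = x} (s≤s m≤n) 0≤x = ℚₚ.+-monoʳ-≤ x (·-monoˡ-≤ m≤n 0≤x)

length·≤sumℚ : ∀ {b xs} → All (b ℚ.≤_) xs → length xs · b ℚ.≤ sumℚ xs
length·≤sumℚ []       = ℚₚ.≤-refl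
length·≤sumℚ (p ∷ ps) = ℚₚ.+-mono-≤ p (length·≤sumℚ ps)

sumℚ≤length· : ∀ {b xs} → All (ℚ._≤ b) xs → sumℚ xs ℚ.≤ length xs · b
sumℚ≤length· []       = ℚₚ.≤-refl
sumℚ≤length· (p ∷ ps) = ℚₚ.+-mono-≤ p (sumℚ≤length· ps)

2ℚ* : ∀ q → 2ℚ ℚ.* q ≡ q ℚ.+ q
2ℚ* q = trans (ℚₚ.*-distribʳ-+ q 1ℚ 1ℚ) (cong₂ ℚ._+_ (ℚₚ.*-identityˡ q) (ℚₚ.*-identityˡ q))

-- Bit lengths under doubling.

bits-mono : ∀ {m n} → m ≤ n → bits m ≤ bits n
bits-mono m≤n = s≤s (⌊log₂⌋-mono-≤ m≤n)

bits-2* : ∀ m → bits (2 * m) ≤ suc (bits m)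
bits-2* zero      = s≤s z≤n
bits-2* m@(suc _) = ℕₚ.≤-reflexive (cong suc (⌊log₂[2*b]⌋≡1+⌊log₂b⌋ m))

-- Before cancellation the numerator gains one bit and the denominator none; cancelling a common
-- factor only makes both smaller.
size-double : ∀ q → size (2ℚ ℚ.* q) ≤ suc (size q)
size-double q = shrink _ (ℚₚ.↥-* 2ℚ q) (ℚₚ.↧-* 2ℚ q)
  where
  -- d is the common factor cancelled from 2p / q.
  shrink : ∀ d → ↥ (2ℚ ℚ.* q) ℤ.* d ≡ ℤ.+ 2 ℤ.* ↥ q →
           ↧ (2ℚ ℚ.* q) ℤ.* d ≡ ℤ.+ 1 ℤ.* ↧ q → size (2ℚ ℚ.* q) ≤ suc (size q)
  shrink d num den = ℕₚ.+-mono-≤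
    (ℕₚ.≤-trans (bits-mono num≤) (bits-2* ℤ.∣ ↥ q ∣)) (bits-mono den≤)
    where
    abs* : ∀ x {y} → x ℤ.* d ≡ y → ℤ.∣ x ∣ * ℤ.∣ d ∣ ≡ ℤ.∣ y ∣
    abs* x eq = trans (sym (ℤₚ.abs-* x d)) (cong ℤ.∣_∣ eq)
    num′ : ℤ.∣ ↥ (2ℚ ℚ.* q) ∣ * ℤ.∣ d ∣ ≡ 2 * ℤ.∣ ↥ q ∣
    num′ = trans (abs* (↥ (2ℚ ℚ.* q)) num) (ℤₚ.abs-* (ℤ.+ 2) (↥ q))
    den′ : ↧ₙ (2ℚ ℚ.* q) * ℤ.∣ d ∣ ≡ ↧ₙ q
    den′ = trans (abs* (↧ (2ℚ ℚ.* q)) den) (cong ℤ.∣_∣ (ℤₚ.*-identityˡ (↧ q)))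
    instance
      d≢0 : NonZero ℤ.∣ d ∣
      -- If the cancelled factor were 0, `den′` would make the denominator of `q` vanish.
      d≢0 = ℕ.≢-nonZero λ d≡0 → ℕ.≢-nonZero⁻¹ (↧ₙ q)
        (trans (sym den′) (trans (cong (↧ₙ (2ℚ ℚ.* q) *_) d≡0) (ℕₚ.*-zeroʳ (↧ₙ (2ℚ ℚ.* q)))))
    num≤ : ℤ.∣ ↥ (2ℚ ℚ.* q) ∣ ≤ 2 * ℤ.∣ ↥ q ∣
    num≤ = subst (ℤ.∣ ↥ (2ℚ ℚ.* q) ∣ ≤_) num′ (ℕₚ.m≤m*n _ ℤ.∣ d ∣)
    den≤ : ↧ₙ (2ℚ ℚ.* q) ≤ ↧ₙ q
    den≤ = subst (↧ₙ (2ℚ ℚ.* q) ≤_) den′ (ℕₚ.m≤m*n (↧ₙ (2ℚ ℚ.* q)) ℤ.∣ d ∣)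

-- Preprocessing

rate : ∀ {n} → Rated n → ℚ
rate = proj₁

sizesWithin : ∀ {n} → ℕ → List (Rated n) → Set
sizesWithin s = All (λ x → size (rate x) ≤ s)

comparisonBound : ℕ → ℕ
comparisonBound s = suc ((s + s) * (s + s))

comparison-≤ : ∀ {s} a b → size a ≤ s → size b ≤ s → 1 + compareCost a b ≤ comparisonBound s
comparison-≤ a b a≤s b≤s = s≤s (ℕₚ.*-mono-≤ p p)
  where p = ℕₚ.+-mono-≤ a≤s b≤s

initial : ∀ {n} → (Fin n → ℚ) → List (Fin n) → List (Rated n)
initial g es = map (λ e → g e , leaf e) (filter (λ e → ¬? (g e ℚₚ.≟ 0ℚ)) es)

singletons-triple : ∀ {n} (g : Fin n → ℚ) es →
  Triple (singletons g es) (suc (length es + sum (map (size ∘ g) es))) (_≡ initial g es)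
singletons-triple g []       = spend 1 (ret refl)
singletons-triple g (e ∷ es) = relax (ℕₚ.≤-reflexive (rearrange (size (g e)) (length es) _)) cons
  where
  rearrange : ∀ s l t → 1 + s + (suc (l + t) + 0) ≡ suc (suc l + (s + t))
  rearrange = solve-∀
  cons : Triple (singletons g (e ∷ es))
                (1 + size (g e) + (suc (length es + sum (map (size ∘ g) es)) + 0))
                (_≡ initial g (e ∷ es))
  cons with g e ℚₚ.≟ 0ℚ
  ... | yes _ = spend (1 + size (g e)) (bind (singletons-triple g es) λ _ eq → ret eq)
  ... | no  _ = spend (1 + size (g e)) (bind (singletons-triple g es) λ _ eq → ret (cong (_ ∷_) eq))

Minimum : ∀ {n} → List (Rated n) → Rated n → List (Rated n) → Set
Minimum H x xs = All (λ y → rate x ℚ.≤ rate y) xs × x ∷ xs ↭ H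

keepFirst : ∀ {n} {H : List (Rated n)} {x z zs} → rate x ℚ.≤ rate z →
            Minimum H z zs → Minimum (x ∷ H) x (z ∷ zs)
keepFirst {x = x} x≤z (min , perm) = x≤z ∷ All.map (ℚₚ.≤-trans x≤z) min , ↭-prep x perm

passFirst : ∀ {n} {H : List (Rated n)} {x z zs} → rate z ℚ.≤ rate x →
            Minimum H z zs → Minimum (x ∷ H) z (x ∷ zs)
passFirst {x = x} {z} z≤x (min , perm) =
  z≤x ∷ min , ↭-trans (↭-swap z x ↭-refl) (↭-prep x perm)

comparisonTime : ∀ {n s t z} {H zs : List (Rated n)} m a → size a ≤ s → sizesWithin s H →
  t ≤ m * comparisonBound s → Minimum H z zs →
  t + (1 + compareCost a (rate z) + 0) ≤ suc m * comparisonBound s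
comparisonTime {s = s} {z = z} m a a≤s ss t≤ (_ , perm) = ℕₚ.≤-trans
  (ℕₚ.+-mono-≤ t≤ (ℕₚ.+-monoˡ-≤ 0 (comparison-≤ a (rate z) a≤s z≤s)))
  (ℕₚ.≤-reflexive (rearrange m (comparisonBound s)))
  where
  z≤s : size (rate z) ≤ s
  z≤s with z≤s ∷ _ ← All-resp-↭ (↭-sym perm) ss = z≤s
  rearrange : ∀ m K → m * K + (K + 0) ≡ suc m * K
  rearrange = solve-∀

extractMin-triple : ∀ {n m} s (H : Vec (Rated n) (suc m)) → sizesWithin s (Vec.toList H) →
  Triple (extractMin H) (suc m * comparisonBound s)
         (λ (z , zs) → Minimum (Vec.toList H) z (Vec.toList zs))
extractMin-triple s (x ∷ []) _ = relax (s≤s z≤n) (spend 1 (ret ([] , ↭-refl)))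
-- `select` is local to `extractMin`, so the derivation is taken apart by hand until the comparison
-- is known and `select` reduces. A tie leaves two derivations to treat.
extractMin-triple {m = suc m} s ((a , S) ∷ y ∷ ys) (a≤s ∷ ss) .run d
  with >>=-split (extractMin (y ∷ ys)) d
... | (z , zs) , _ , _ , d₁ , ⇓-step d₂ , refl
  with extractMin-triple s (y ∷ ys) ss .run d₁ | ℚₚ.<-cmp a (rate z) | d₂
... | t≤ , post | tri< x<z _ _ | ⇓-return =
  comparisonTime (suc m) a a≤s ss t≤ post , keepFirst (ℚₚ.<⇒≤ x<z) post
... | t≤ , post | tri≈ _ x≡z _ | ⇓-left ⇓-return =
  comparisonTime (suc m) a a≤s ss t≤ post , keepFirst (ℚₚ.≤-reflexive x≡z) post
... | t≤ , post | tri≈ _ x≡z _ | ⇓-right ⇓-return =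
  comparisonTime (suc m) a a≤s ss t≤ post , passFirst (ℚₚ.≤-reflexive (sym x≡z)) post
... | t≤ , post | tri> _ _ z<x | ⇓-return =
  comparisonTime (suc m) a a≤s ss t≤ post , passFirst (ℚₚ.<⇒≤ z<x) post

-- The new rate is written with the second rate alone, as the maximum is known once the trees are
-- ordered. The constructors are the two choices of left child.
data Joins {n} : Rated n → Rated n → Rated n → Set where
  in-order : ∀ {a b S T} → Joins (a , S) (b , T) (2ℚ ℚ.* b , node false S T)
  reversed : ∀ {a b S T} → Joins (a , S) (b , T) (2ℚ ℚ.* b , node false T S)

record FusesTo {n} (H H′ : List (Rated n)) : Set where
  field
    {S T U}  : Rated n
    {rest}   : List (Rated n)
    minimal  : H ↭ S ∷ T ∷ rest
    S≤T      : rate S ℚ.≤ rate T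
    T≤rest   : All (λ x → rate T ℚ.≤ rate x) rest
    joins    : Joins S T U
    result   : H′ ≡ U ∷ rest

fuse-triple : ∀ {n} s (S T : Rated n) → size (rate S) ≤ s → size (rate T) ≤ s →
  rate S ℚ.≤ rate T → Triple (fuse S T ⊕ fuse T S) (comparisonBound s + s) (Joins S T)
fuse-triple s (a , S) (b , T) a≤s b≤s a≤b =
  choose (relax (cost a b a≤s b≤s a⊔b≡b) (spend _ (ret forth)))
         (relax (cost b a b≤s a≤s b⊔a≡b) (spend _ (ret back)))
  where
  a⊔b≡b = ℚₚ.p≤q⇒p⊔q≡q a≤b
  b⊔a≡b = ℚₚ.p≥q⇒p⊔q≡p a≤b
  forth : Joins (a , S) (b , T) (2ℚ ℚ.* (a ⊔ b) , node false S T)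
  forth rewrite a⊔b≡b = in-order
  back : Joins (a , S) (b , T) (2ℚ ℚ.* (b ⊔ a) , node false T S)
  back rewrite b⊔a≡b = reversed
  cost : ∀ p q → size p ≤ s → size q ≤ s → p ⊔ q ≡ b →
         1 + compareCost p q + doubleCost (p ⊔ q) + 0 ≤ comparisonBound s + s
  cost p q p≤s q≤s eq = ℕₚ.≤-trans (ℕₚ.≤-reflexive (ℕₚ.+-identityʳ _))
    (ℕₚ.+-mono-≤ (comparison-≤ p q p≤s q≤s) (subst (λ r → size r ≤ s) (sym eq) b≤s))

fuseRound-triple : ∀ {n m} s (H : Vec (Rated n) (suc (suc m))) → sizesWithin s (Vec.toList H) →
  Triple (fuseRound H)
    (suc (suc m) * comparisonBound s + (suc m * comparisonBound s + (comparisonBound s + s + 0)))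
    (λ H′ → FusesTo (Vec.toList H) (Vec.toList H′))
fuseRound-triple s H ss =
  bind (extractMin-triple s H ss) λ (S , H₁) (S-min , perm₁) →
  let sS∷ss₁ = All-resp-↭ (↭-sym perm₁) ss in
  bind (extractMin-triple s H₁ (All.tail sS∷ss₁)) λ (T , H₂) (T-min , perm₂) →
  let S≤T = All.head (All-resp-↭ (↭-sym perm₂) S-min) in
  bind (fuse-triple s S T (All.head sS∷ss₁)
         (All.head (All-resp-↭ (↭-sym perm₂) (All.tail sS∷ss₁))) S≤T) λ U joins →
  ret record
    { minimal = ↭-trans (↭-sym perm₁) (↭-prep S (↭-sym perm₂))
    ; S≤T = S≤T ; T≤rest = T-min ; joins = joins ; result = refl }

-- Visits e T p w: the leaf e of T is reached once every p walks, next
-- after w further walks.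
data Visits {n} (e : Fin n) : Tree n → (p w : ℕ) → Set where
  here        : Visits e (leaf e) 1 0
  left-now    : ∀ {l r p w} → Visits e l p w → Visits e (node true  l r) (p + p) (w + w)
  left-later  : ∀ {l r p w} → Visits e l p w → Visits e (node false l r) (p + p) (suc (w + w))
  right-now   : ∀ {l r p w} → Visits e r p w → Visits e (node false l r) (p + p) (w + w)
  right-later : ∀ {l r p w} → Visits e r p w → Visits e (node true  l r) (p + p) (suc (w + w))

-- The invariant of fusing.

leaves : ∀ {n} → Tree n → ℕ
leaves (leaf _)     = 1
leaves (node _ l r) = leaves l + leaves r

-- Here `p` is the period of `e`, so `p · g e` is the growth between two visits, and the rate of the
-- tree has to dominate it.
Covers : ∀ {n} → (Fin n → ℚ) → Fin n → Rated n → Set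
Covers g e (r , T) = ∃[ p ] ∃[ w ] (Visits e T p w × p · g e ℚ.≤ r)

leafCount : ∀ {n} → List (Rated n) → ℕ
leafCount H = sum (map (leaves ∘ proj₂) H)

-- Fusing trees of rates a ≤ b raises the total rate by b − a.  The floor
-- rises from at most a to b, which pays for the increase.
record Invariant {n} (g : Fin n → ℚ) (κ s ℓ : ℕ) (H : List (Rated n)) : Set where
  field
    floor   : ℚ
    0≤floor : 0ℚ ℚ.≤ floor
    above   : All (λ x → floor ℚ.≤ rate x) H
    total   : sumℚ (map rate H) ℚ.≤ κ · 1ℚ ℚ.+ floor
    below   : All (λ x → rate x ℚ.≤ 2ℚ) H
    sizes   : sizesWithin s H
    count   : leafCount H ≡ ℓ
    covered : ∀ e → g e ≢ 0ℚ → Any (Covers g e) H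
open Invariant

-- If `b` exceeded 1, the sum would exceed the length of `xs`, hence `κ`. The inequality is strict
-- because there is at least one entry.
average-≤1 : ∀ {b} κ xs → 1 ≤ length xs → κ ≤ length xs → All (b ℚ.≤_) xs →
             sumℚ xs ℚ.≤ κ · 1ℚ → b ℚ.≤ 1ℚ
average-≤1 {b} κ xs@(_ ∷ ys) _ κ≤ b≤xs sum≤ = ℚₚ.≮⇒≥ λ 1<b → ℚₚ.<-irrefl refl (ℚₚ.<-≤-trans
  (ℚₚ.+-mono-<-≤ 1<b (·-monoʳ-≤ (length ys) (ℚₚ.<⇒≤ 1<b)))
  (ℚₚ.≤-trans (length·≤sumℚ b≤xs) (ℚₚ.≤-trans sum≤ (·-monoˡ-≤ κ≤ (ℚₚ.nonNegative⁻¹ 1ℚ)))))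

-- Becoming a child doubles the period of a leaf. Either child has rate at most `b`, so twice `b`
-- still dominates the growth over the longer period.
double-covers : ∀ {n} (g : Fin n → ℚ) e p {a b} → p · g e ℚ.≤ a → a ℚ.≤ b →
                (p + p) · g e ℚ.≤ 2ℚ ℚ.* b
double-covers g e p {a} {b} p≤a a≤b = begin
  (p + p) · g e          ≡⟨ ×-homo-+ (g e) p p ⟩
  p · g e ℚ.+ p · g e    ≤⟨ ℚₚ.+-mono-≤ p≤b p≤b ⟩
  b ℚ.+ b                ≡⟨ 2ℚ* b ⟨
  2ℚ ℚ.* b               ∎
  where
  open ℚₚ.≤-Reasoning
  p≤b = ℚₚ.≤-trans p≤a a≤b

covers-join : ∀ {n} {g : Fin n → ℚ} {e S T U} → Joins S T U → rate S ℚ.≤ rate T →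
              Covers g e S ⊎ Covers g e T → Covers g e U
covers-join {g = g} {e} in-order S≤T (inj₁ (p , _ , v , c)) =
  _ , _ , left-later v , double-covers g e p c S≤T
covers-join {g = g} {e} in-order S≤T (inj₂ (p , _ , v , c)) =
  _ , _ , right-now v , double-covers g e p c ℚₚ.≤-refl
covers-join {g = g} {e} reversed S≤T (inj₁ (p , _ , v , c)) =
  _ , _ , right-now v , double-covers g e p c S≤T
covers-join {g = g} {e} reversed S≤T (inj₂ (p , _ , v , c)) =
  _ , _ , left-later v , double-covers g e p c ℚₚ.≤-refl

rate-join : ∀ {n} {S T U : Rated n} → Joins S T U → rate U ≡ 2ℚ ℚ.* rate T
rate-join in-order = refl
rate-join reversed = refl

leaves-join : ∀ {n} {S T U : Rated n} → Joins S T U →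
              leaves (proj₂ U) ≡ leaves (proj₂ S) + leaves (proj₂ T)
leaves-join in-order = refl
leaves-join {S = _ , S} {_ , T} reversed = ℕₚ.+-comm (leaves T) (leaves S)

fuse-invariant : ∀ {n} {g : Fin n → ℚ} {κ s ℓ H H′} → κ ℕ.< length H → FusesTo H H′ →
                 Invariant g κ s ℓ H → Invariant g κ (suc s) ℓ H′
fuse-invariant {n} {g} {κ} {s} {ℓ} {H} {H′} κ<H f inv =
  subst (Invariant g κ (suc s) ℓ) (sym (f .result)) fused
  where
  open FusesTo hiding (S; T; U; rest)
  S = FusesTo.S f
  T = FusesTo.T f
  U = FusesTo.U f
  rest = FusesTo.rest f
  a = rate S
  b = rate T
  m = inv .floor
  m≤a : m ℚ.≤ a
  m≤a = All.head (All-resp-↭ (f .minimal) (inv .above))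
  U≡ : rate U ≡ b ℚ.+ b
  U≡ = trans (rate-join (f .joins)) (2ℚ* b)
  total′ : a ℚ.+ (b ℚ.+ sumℚ (map rate rest)) ℚ.≤ κ · 1ℚ ℚ.+ m
  total′ = subst (ℚ._≤ _) (sumℚ-↭ (↭-map⁺ rate (f .minimal))) (inv .total)
  others≤κ : b ℚ.+ sumℚ (map rate rest) ℚ.≤ κ · 1ℚ
  -- An excess over `κ`, added to `m ≤ a`, would push the total past `κ · 1ℚ + m`.
  others≤κ = ℚₚ.≮⇒≥ λ κ< → ℚₚ.<-irrefl refl (ℚₚ.<-≤-trans (ℚₚ.+-mono-≤-< m≤a κ<)
    (subst (a ℚ.+ (b ℚ.+ sumℚ (map rate rest)) ℚ.≤_) (ℚₚ.+-comm (κ · 1ℚ) m) total′))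
  b≤1 : b ℚ.≤ 1ℚ
  b≤1 = average-≤1 κ (map rate (T ∷ rest)) (s≤s z≤n)
    -- More than `κ` trees were present, so at least `κ` remain once `S` is set aside.
    (subst (κ ≤_) (cong suc (sym (length-map rate rest)))
      (ℕₚ.≤-pred (subst (κ ℕ.<_) (↭-length (f .minimal)) κ<H)))
    (ℚₚ.≤-refl ∷ Allₚ.map⁺ (f .T≤rest)) others≤κ
  0≤b : 0ℚ ℚ.≤ b
  0≤b = ℚₚ.≤-trans (inv .0≤floor) (ℚₚ.≤-trans m≤a (f .S≤T))
  olds : ∀ {P : Rated n → Set} → All P H → P T × All P rest
  olds ps with _ ∷ pT ∷ prest ← All-resp-↭ (f .minimal) ps = pT , prest
  fused : Invariant g κ (suc s) ℓ (U ∷ rest)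
  fused = record
    { floor   = b
    ; 0≤floor = 0≤b
    -- Nonnegativity of `b` places the fused rate `b + b` above the new floor `b`.
    ; above   = subst (b ℚ.≤_) (sym U≡) (subst (ℚ._≤ b ℚ.+ b) (ℚₚ.+-identityʳ b) (ℚₚ.+-monoʳ-≤ b 0≤b))
                ∷ f .T≤rest
    ; total   = begin
        rate U ℚ.+ R        ≡⟨ cong (ℚ._+ R) U≡ ⟩
        b ℚ.+ b ℚ.+ R       ≡⟨ ℚₚ.+-assoc b b R ⟩
        b ℚ.+ (b ℚ.+ R)     ≤⟨ ℚₚ.+-monoʳ-≤ b others≤κ ⟩
        b ℚ.+ κ · 1ℚ        ≡⟨ ℚₚ.+-comm b _ ⟩
        κ · 1ℚ ℚ.+ b        ∎
    ; below   = subst (ℚ._≤ 2ℚ) (sym U≡) (ℚₚ.+-mono-≤ b≤1 b≤1) ∷ proj₂ (olds (inv .below))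
    ; sizes   = subst (λ q → size q ≤ suc s) (sym (rate-join (f .joins)))
                  (ℕₚ.≤-trans (size-double b) (s≤s (proj₁ (olds (inv .sizes)))))
                ∷ All.map ℕₚ.m≤n⇒m≤1+n (proj₂ (olds (inv .sizes)))
    ; count   = trans (cong (_+ leafCount rest) (leaves-join (f .joins)))
                  (trans (ℕₚ.+-assoc (leaves (proj₂ S)) _ _)
                    (trans (sym (sum-↭ (↭-map⁺ (leaves ∘ proj₂) (f .minimal)))) (inv .count)))
    ; covered = λ e e≢0 → cover e (Any-resp-↭ (f .minimal) (inv .covered e e≢0))
    }
    where
    open ℚₚ.≤-Reasoning
    R = sumℚ (map rate rest)
    cover : ∀ e → Any (Covers g e) (S ∷ T ∷ rest) → Any (Covers g e) (U ∷ rest)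
    cover e (here c)          = here (covers-join {g = g} (f .joins) (f .S≤T) (inj₁ c))
    cover e (there (here c))  = here (covers-join {g = g} (f .joins) (f .S≤T) (inj₂ c))
    cover e (there (there c)) = there c

-- `D` bounds the number of trees, `b` the bit length of the target and `M` the sizes of all rates.
-- The summands pay for the loop test, two extractions and one fusion; the leading `suc` makes the
-- unit charge of a stopping loop fit as well.
roundBound : ℕ → ℕ → ℕ → ℕ
roundBound D b M =
  suc (D + b + (D * comparisonBound M + (D * comparisonBound M + (comparisonBound M + M))))

-- A round removes one tree and lengthens rates by at most one bit, so `m + s` stays constant and a
-- single `M` bounds all sizes throughout the loop.
fuseLoop-triple : ∀ {n} {g : Fin n → ℚ} {ℓ D M} κ m s (H : Vec (Rated n) m) →
  (1 ≤ m → 1 ≤ κ) → m ≤ D → m + s ≤ M → Invariant g κ s ℓ (Vec.toList H) →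
  Triple (fuseLoop κ m H) (suc m * roundBound D (bits κ) M)
         (λ H′ → length H′ ≤ κ × ∃[ s′ ] Invariant g κ s′ ℓ H′)
fuseLoop-triple κ zero s [] _ _ _ inv =
  relax (s≤s z≤n) (spend 1 (ret (z≤n , s , inv)))
-- The premise `nonzero` excludes `κ = 0`, where stopping with one tree would leave too many.
fuseLoop-triple κ (suc zero) s (x ∷ []) nonzero _ _ inv =
  relax (s≤s z≤n) (spend 1 (ret (nonzero (s≤s z≤n) , s , inv)))
fuseLoop-triple {n} {g} {ℓ} {D} {M} κ (suc (suc m)) s H nonzero m≤D ms≤M inv =
  relax cost (spend (suc (suc m) + bits κ) (branch (suc (suc m) ≤? κ)
    (λ m≤κ → ret (subst (_≤ κ) (sym len) m≤κ , s , inv))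
    (λ m≰κ → bind (fuseRound-triple s H (inv .sizes)) λ H′ fuses →
      fuseLoop-triple κ (suc m) (suc s) H′ (λ _ → nonzero (s≤s z≤n))
        (ℕₚ.<⇒≤ m≤D) (subst (_≤ M) (cong suc (sym (ℕₚ.+-suc m s))) ms≤M)
        (fuse-invariant (subst (κ ℕ.<_) (sym len) (ℕₚ.≰⇒> m≰κ)) fuses inv))))
  where
  K = comparisonBound
  R = roundBound D (bits κ) M
  m2 = suc (suc m)
  round : ℕ
  round = m2 * K s + (suc m * K s + (K s + s + 0))
  len : length (Vec.toList H) ≡ m2
  len = length-toList H
  s≤M : s ≤ M
  s≤M = ℕₚ.≤-trans (ℕₚ.m≤n+m s m2) ms≤M
  K≤ : K s ≤ K M
  K≤ = s≤s (ℕₚ.*-mono-≤ (ℕₚ.+-mono-≤ s≤M s≤M) (ℕₚ.+-mono-≤ s≤M s≤M))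
  cost : m2 + bits κ + (round + m2 * R) ≤ suc m2 * R
  cost = ℕₚ.≤-trans (ℕₚ.≤-reflexive (sym (ℕₚ.+-assoc (m2 + bits κ) round _)))
    (ℕₚ.+-monoˡ-≤ (m2 * R) (ℕₚ.m≤n⇒m≤1+n (ℕₚ.+-mono-≤ (ℕₚ.+-monoˡ-≤ (bits κ) m≤D)
      (ℕₚ.+-mono-≤ (ℕₚ.*-mono-≤ m≤D K≤) (ℕₚ.+-mono-≤ (ℕₚ.*-mono-≤ (ℕₚ.<⇒≤ m≤D) K≤)
        (ℕₚ.≤-trans (ℕₚ.≤-reflexive (ℕₚ.+-identityʳ _)) (ℕₚ.+-mono-≤ K≤ s≤M)))))))

-- Consequences of the coefficients

indicator : ∀ {n} → Subset n → ℚ → Fin n → ℚ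
indicator I x e = if does (e ∈? I) then x else 0ℚ

sum-indicator : ∀ {n} (I : Subset n) x → sumℚ (tabulate (indicator I x)) ≡ ∣ I ∣ · x
sum-indicator []            x = refl
sum-indicator (inside  ∷ I) x = cong (x ℚ.+_) (sum-indicator I x)
sum-indicator (outside ∷ I) x = trans (ℚₚ.+-identityˡ _) (sum-indicator I x)

sumℚ-map-+ : ∀ {A : Set} (f h : A → ℚ) xs →
             sumℚ (map (λ a → f a ℚ.+ h a) xs) ≡ sumℚ (map f xs) ℚ.+ sumℚ (map h xs)
sumℚ-map-+ f h []       = refl
sumℚ-map-+ f h (x ∷ xs) =
  trans (cong (f x ℚ.+ h x ℚ.+_) (sumℚ-map-+ f h xs)) (+-interchange (f x) (h x) _ _)

sumℚ-map-0 : ∀ {A : Set} (xs : List A) → sumℚ (map (λ _ → 0ℚ) xs) ≡ 0ℚ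
sumℚ-map-0 []       = refl
sumℚ-map-0 (x ∷ xs) = trans (ℚₚ.+-identityˡ _) (sumℚ-map-0 xs)

module _ {n} (c : Subset n → ℚ) where

  load : List (Subset n) → Fin n → ℚ
  load L e = sumℚ (map c (filter (e ∈?_) L))

  load-∷ : ∀ I L e → load (I ∷ L) e ≡ indicator I (c I) e ℚ.+ load L e
  load-∷ I L e with does (e ∈? I)
  ... | true  = refl
  ... | false = sym (ℚₚ.+-identityˡ _)

  load≤ : ∀ {L} e → All (λ I → 0ℚ ℚ.≤ c I) L → load L e ℚ.≤ sumℚ (map c L)
  load≤ e [] = ℚₚ.≤-refl
  load≤ {I ∷ L} e (0≤c ∷ 0≤cs) with does (e ∈? I)
  ... | true  = ℚₚ.+-monoʳ-≤ (c I) (load≤ e 0≤cs)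
  ... | false = subst (ℚ._≤ c I ℚ.+ sumℚ (map c L)) (ℚₚ.+-identityˡ _) (ℚₚ.+-mono-≤ 0≤c (load≤ e 0≤cs))

  -- Double counting: each set `I` contributes `c I` to the load of its elements, of which there are
  -- at most `k`.
  total-load≤ : ∀ {k L} → All (λ I → ∣ I ∣ ≤ k) L → All (λ I → 0ℚ ℚ.≤ c I) L →
                sumℚ (map (load L) (allFin n)) ℚ.≤ k · sumℚ (map c L)
  total-load≤ {k} [] [] = ℚₚ.≤-reflexive (trans (sumℚ-map-0 (allFin n)) (sym (·-zeroʳ k)))
  total-load≤ {k} {I ∷ L} (I≤k ∷ Is≤k) (0≤c ∷ 0≤cs) = begin
    sumℚ (map (load (I ∷ L)) (allFin n))
      ≡⟨ cong sumℚ (map-cong (load-∷ I L) (allFin n)) ⟩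
    sumℚ (map (λ e → indicator I (c I) e ℚ.+ load L e) (allFin n))
      ≡⟨ sumℚ-map-+ (indicator I (c I)) (load L) (allFin n) ⟩
    sumℚ (map (indicator I (c I)) (allFin n)) ℚ.+ sumℚ (map (load L) (allFin n))
      ≡⟨ cong (λ xs → sumℚ xs ℚ.+ sumℚ (map (load L) (allFin n)))
              (map-tabulate id (indicator I (c I))) ⟩
    sumℚ (tabulate (indicator I (c I))) ℚ.+ sumℚ (map (load L) (allFin n))
      ≡⟨ cong (ℚ._+ sumℚ (map (load L) (allFin n))) (sum-indicator I (c I)) ⟩
    ∣ I ∣ · c I ℚ.+ sumℚ (map (load L) (allFin n))
      ≤⟨ ℚₚ.+-mono-≤ (·-monoˡ-≤ I≤k 0≤c) (total-load≤ Is≤k 0≤cs) ⟩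
    k · c I ℚ.+ k · sumℚ (map c L)
      ≡⟨ ·-distrib-+ (c I) (sumℚ (map c L)) k ⟨
    k · (c I ℚ.+ sumℚ (map c L)) ∎
    where open ℚₚ.≤-Reasoning

module _ {n k} {g : Fin n → ℚ} (G : IsCBGT (uniformMatroid n k) g) where
  open IsCBGT G

  private
    L = members (uniformMatroid n k)
    ∣L∣≤k : All (λ I → ∣ I ∣ ≤ k) L
    ∣L∣≤k = Allₚ.all-filter (λ X → ∣ X ∣ ≤? k) (subsets n)
    0≤cs : All (λ I → 0ℚ ℚ.≤ coeff I) L
    -- Membership in the uniform matroid unfolds to `∣ I ∣ ≤ k`, so `∣L∣≤k` also serves as the proof
    -- of membership.
    0≤cs = All.map (λ {I} → c-nonNegative I) ∣L∣≤k

  growth≤1 : ∀ e → g e ℚ.≤ 1ℚ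
  growth≤1 e = subst (ℚ._≤ 1ℚ) (sym (c-growth e)) (subst (load coeff L e ℚ.≤_) c-sum (load≤ coeff e 0≤cs))

  total-growth≤k : sumℚ (map g (allFin n)) ℚ.≤ k · 1ℚ
  total-growth≤k = subst (ℚ._≤ k · 1ℚ) (cong sumℚ (map-cong (sym ∘ c-growth) (allFin n)))
    (subst (λ x → sumℚ (map (load coeff L) (allFin n)) ℚ.≤ k · x) c-sum (total-load≤ coeff ∣L∣≤k 0≤cs))

-- The one-vertex trees and the result of preprocessing.

module _ {n} (g : Fin n → ℚ) where

  initial⁺ : ∀ {P : Rated n → Set} es → (∀ e → P (g e , leaf e)) → All P (initial g es)
  initial⁺ es p = Allₚ.map⁺ (Allₚ.filter⁺ (λ e → ¬? (g e ℚₚ.≟ 0ℚ)) (All.universal p es))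

  initial-length : ∀ es → length (initial g es) ≤ length es
  initial-length es = subst (_≤ length es)
    (sym (length-map (λ e → g e , leaf e) (filter (λ e → ¬? (g e ℚₚ.≟ 0ℚ)) es)))
    (length-filter (λ e → ¬? (g e ℚₚ.≟ 0ℚ)) es)

  initial-total : ∀ es → sumℚ (map rate (initial g es)) ≡ sumℚ (map g es)
  initial-total []       = refl
  initial-total (e ∷ es) with g e ℚₚ.≟ 0ℚ
  ... | yes g≡0 = trans (initial-total es)
    (trans (sym (ℚₚ.+-identityˡ _)) (cong (ℚ._+ sumℚ (map g es)) (sym g≡0)))
  ... | no  _   = cong (g e ℚ.+_) (initial-total es)

  initial-covers : ∀ e → g e ≢ 0ℚ → Any (Covers g e) (initial g (allFin n))
  initial-covers e g≢0 = Anyₚ.map⁺ (Any.map covers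
    (∈-filter⁺ (λ e → ¬? (g e ℚₚ.≟ 0ℚ)) (∈-allFin e) g≢0))
    where
    covers : ∀ {e′} → e ≡ e′ → Covers g e (g e′ , leaf e′)
    covers refl = 1 , 0 , here , ℚₚ.≤-reflexive (ℚₚ.+-identityʳ (g e))

leafCount-leaves : ∀ {n} {H : List (Rated n)} → All (λ x → leaves (proj₂ x) ≡ 1) H →
                   leafCount H ≡ length H
leafCount-leaves []       = refl
leafCount-leaves (p ∷ ps) = cong₂ _+_ p (leafCount-leaves ps)

sum-maps-≤ : ∀ {A : Set} (f : A → ℕ) {x xs} → x ∈ˡ xs → f x ≤ sum (map f xs)
sum-maps-≤ f {xs = y ∷ _} (here refl)  = ℕₚ.m≤m+n (f y) _
sum-maps-≤ f {xs = y ∷ _} (there x∈xs) = ℕₚ.m≤n⇒m≤o+n (f y) (sum-maps-≤ f x∈xs)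

sumℚ-positive : ∀ {xs} → 1 ≤ length xs → All (0ℚ ℚ.<_) xs → 0ℚ ℚ.< sumℚ xs
sumℚ-positive {_ ∷ xs} _ (0<x ∷ 0<xs) = ℚₚ.+-mono-<-≤ 0<x
  (ℚₚ.≤-trans (0≤· (length xs) ℚₚ.≤-refl) (length·≤sumℚ (All.map ℚₚ.<⇒≤ 0<xs)))

0≤∧≢0⇒0< : ∀ {q} → 0ℚ ℚ.≤ q → q ≢ 0ℚ → 0ℚ ℚ.< q
0≤∧≢0⇒0< 0≤q q≢0 = ℚₚ.≰⇒> λ q≤0 → q≢0 (ℚₚ.≤-antisym q≤0 0≤q)

-- The summands are the four phases of `preprocess`. A round costs a cubic polynomial and there are
-- linearly many, hence degree 4. The constant 41 is the value of the left side at `N = 1`, where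
-- the slack vanishes.
polynomial-bound : ∀ N → 1 ≤ N → N + (N + (suc N * roundBound N N N + (N + 0))) ≤ 41 * N ^ 4
polynomial-bound (suc p) _ = ℕₚ.≤-trans (ℕₚ.m≤m+n _ _) (ℕₚ.≤-reflexive (difference p))
  where
  -- The slack is written as a polynomial in p = N − 1 with coefficients ≥ 0.
  difference : ∀ p →
    (1 + p) + ((1 + p) + ((2 + p) * (1 + ((1 + p) + (1 + p)
      + ((1 + p) * (1 + ((1 + p) + (1 + p)) * ((1 + p) + (1 + p)))
      + ((1 + p) * (1 + ((1 + p) + (1 + p)) * ((1 + p) + (1 + p)))
      + ((1 + ((1 + p) + (1 + p)) * ((1 + p) + (1 + p))) + (1 + p)))))) + ((1 + p) + 0)))
    + p * (68 + p * (153 + p * (120 + p * 33)))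
    ≡ 41 * ((1 + p) * ((1 + p) * ((1 + p) * ((1 + p) * 1))))
  difference = solve-∀

VisitedIn : ∀ {n} → Fin n → List (Tree n) → (p w : ℕ) → Set
VisitedIn e F p w = Any (λ T → Visits e T p w) F

CoveredBy : ∀ {n} → (Fin n → ℚ) → Fin n → List (Tree n) → Set
CoveredBy g e F = ∃[ p ] ∃[ w ] (VisitedIn e F p w × p · g e ℚ.≤ 2ℚ)

coveredBy : ∀ {n} {g : Fin n → ℚ} {e H} → All (λ x → rate x ℚ.≤ 2ℚ) H → Any (Covers g e) H →
            CoveredBy g e (map proj₂ H)
coveredBy (r≤2 ∷ _) (here (p , w , v , p≤r)) = p , w , here v , ℚₚ.≤-trans p≤r r≤2
coveredBy {g = g} {e} (_ ∷ rs) (there c) =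
  let p , w , v , p≤2 = coveredBy {g = g} {e} rs c in p , w , there v , p≤2

record Prepared {n} (k : ℕ) (g : Fin n → ℚ) (F : List (Tree n)) : Set where
  field
    trees≤    : length F ≤ k
    leaves≤   : sum (map leaves F) ≤ n
    covering  : ∀ e → g e ≢ 0ℚ → CoveredBy g e F

-- The inequality is strict because `bits k` is positive; the spare unit pays for the `suc` in the
-- time of `singletons`.
n+sizes<inputSize : ∀ n k (g : Fin n → ℚ) → n + sum (map (size ∘ g) (allFin n)) ℕ.< inputSize n k g
n+sizes<inputSize n k g = begin
  suc (n + Σs)     ≡⟨ ℕₚ.+-suc n Σs ⟨
  n + suc Σs       ≤⟨ ℕₚ.+-monoʳ-≤ n (s≤s (ℕₚ.m≤n+m Σs _)) ⟩
  n + (bits k + Σs) ≡⟨ ℕₚ.+-assoc n _ Σs ⟨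
  n + bits k + Σs  ∎
  where
  open ℕₚ.≤-Reasoning
  Σs = sum (map (size ∘ g) (allFin n))

module _ {n k} {g : Fin n → ℚ} (G : IsCBGT (uniformMatroid n k) g) where
  open IsCBGT G using (g-nonNegative)

  private
    H  = initial g (allFin n)
    N  = inputSize n k g
    κ  = k ⊓ length H
    Σs = sum (map (size ∘ g) (allFin n))

    length≤n : length H ≤ n
    length≤n = subst (length H ≤_) (length-tabulate id) (initial-length g (allFin n))

    n+Σs<N : suc (n + Σs) ≤ N
    n+Σs<N = n+sizes<inputSize n k g

    n+bits≤N : n + bits k ≤ N
    n+bits≤N = ℕₚ.m≤m+n _ Σs

    n≤N : n ≤ N
    n≤N = ℕₚ.≤-trans (ℕₚ.m≤m+n n (bits k)) n+bits≤N

    positive : All (λ x → 0ℚ ℚ.< rate x) H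
    positive = Allₚ.map⁺ (All.map (λ {e} → 0≤∧≢0⇒0< (g-nonNegative e))
                 (Allₚ.all-filter (λ e → ¬? (g e ℚₚ.≟ 0ℚ)) (allFin n)))

    total≤k : sumℚ (map rate H) ℚ.≤ k · 1ℚ
    total≤k = subst (ℚ._≤ k · 1ℚ) (sym (initial-total g (allFin n))) (total-growth≤k G)

    total≤length : sumℚ (map rate H) ℚ.≤ length H · 1ℚ
    total≤length = subst (λ l → sumℚ (map rate H) ℚ.≤ l · 1ℚ) (length-map rate H)
      (sumℚ≤length· (Allₚ.map⁺ (initial⁺ g (allFin n) (growth≤1 G))))

    total≤κ : sumℚ (map rate H) ℚ.≤ κ · 1ℚ
    total≤κ with ℕₚ.⊓-sel k (length H)
    ... | inj₁ κ≡ = subst (λ l → sumℚ (map rate H) ℚ.≤ l · 1ℚ) (sym κ≡) total≤k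
    -- If `κ` is the number of trees, the bound comes from every rate being at most 1.
    ... | inj₂ κ≡ = subst (λ l → sumℚ (map rate H) ℚ.≤ l · 1ℚ) (sym κ≡) total≤length

    -- For `k = 0` the total rate would be at most 0, but every kept rate is positive.
    nonempty⇒1≤k : 1 ≤ length H → 1 ≤ k
    nonempty⇒1≤k 1≤H = ℕₚ.n≢0⇒n>0 λ k≡0 → ℚₚ.<-irrefl refl (ℚₚ.<-≤-trans
      (sumℚ-positive (subst (1 ≤_) (sym (length-map rate H)) 1≤H) (Allₚ.map⁺ positive))
      (subst (λ l → sumℚ (map rate H) ℚ.≤ l · 1ℚ) k≡0 total≤k))

    initial-invariant : Invariant g κ Σs (length H) H
    initial-invariant = record
      -- With floor 0 the bound on the total is just `κ`.
      { floor   = 0ℚ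
      ; 0≤floor = ℚₚ.≤-refl
      ; above   = All.map ℚₚ.<⇒≤ positive
      ; total   = subst (sumℚ (map rate H) ℚ.≤_) (sym (ℚₚ.+-identityʳ _)) total≤κ
      ; below   = initial⁺ g (allFin n) λ e → ℚₚ.≤-trans (growth≤1 G e) 1≤2
      ; sizes   = initial⁺ g (allFin n) λ e → sum-maps-≤ (size ∘ g) (∈-allFin e)
      ; count   = leafCount-leaves (initial⁺ g (allFin n) λ _ → refl)
      ; covered = initial-covers g
      }
      where
      1≤2 : 1ℚ ℚ.≤ 2ℚ
      1≤2 = ℚₚ.+-monoʳ-≤ 1ℚ (ℚₚ.nonNegative⁻¹ 1ℚ)

  preprocess-triple : Triple (preprocess k g) (41 * N ^ 4) (Prepared k g)
  preprocess-triple = relax cost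
    (bind (singletons-triple g (allFin n)) λ { _ refl →
     spend (length H + bits k) (bind
       (fuseLoop-triple κ (length H) Σs (Vec.fromList H)
         (λ 1≤H → ℕₚ.⊓-glb (nonempty⇒1≤k 1≤H) 1≤H)
         (ℕₚ.≤-trans length≤n n≤N) (ℕₚ.≤-trans (ℕₚ.+-monoˡ-≤ Σs length≤n) (ℕₚ.<⇒≤ n+Σs<N))
         (subst (Invariant g κ Σs (length H)) (sym (toList∘fromList H)) initial-invariant))
       λ H′ (H′≤κ , _ , inv) →
       relax (ℕₚ.+-monoˡ-≤ 0 (ℕₚ.≤-trans H′≤κ (ℕₚ.m⊓n≤n k _))) (spend (length H′) (ret record
         { trees≤ = subst (_≤ k) (sym (length-map proj₂ H′)) (ℕₚ.≤-trans H′≤κ (ℕₚ.m⊓n≤m k _))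
         ; leaves≤ = subst (_≤ n) (trans (sym (inv .count)) (cong sum (map-∘ H′))) length≤n
         ; covering = λ e g≢0 → coveredBy {g = g} {e} (inv .below) (inv .covered e g≢0)
         }))) })
    where
    cost : _ ≤ 41 * N ^ 4
    cost = ℕₚ.≤-trans
      (ℕₚ.+-mono-≤ singletons≤N (ℕₚ.+-mono-≤ (ℕₚ.≤-trans (ℕₚ.+-monoˡ-≤ (bits k) length≤n) n+bits≤N)
        (ℕₚ.+-mono-≤ loop≤ (ℕₚ.+-monoˡ-≤ 0 (ℕₚ.≤-trans length≤n n≤N)))))
      (polynomial-bound N (ℕₚ.≤-trans (s≤s z≤n) n+Σs<N))
      where
      singletons≤N : suc (length (allFin n) + Σs) ≤ N
      singletons≤N = subst (λ l → suc (l + Σs) ≤ N) (sym (length-tabulate id)) n+Σs<N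
      bits≤N : bits κ ≤ N
      bits≤N = ℕₚ.≤-trans (bits-mono (ℕₚ.m⊓n≤m k _)) (ℕₚ.≤-trans (ℕₚ.m≤n+m _ n) n+bits≤N)
      loop≤ : suc (length H) * roundBound N (bits κ) N ≤ suc N * roundBound N N N
      loop≤ = ℕₚ.*-mono-≤ (s≤s (ℕₚ.≤-trans length≤n n≤N))
        (s≤s (ℕₚ.+-monoˡ-≤ _ (ℕₚ.+-monoʳ-≤ N bits≤N)))

-- Execution

-- V w says that a countdown stands at w; Advanced V hit w is the outcome
-- of one more step from w, where a countdown at 0 hits and restarts.
Advanced : (ℕ → Set) → Set → ℕ → Set
Advanced V hit zero    = hit × ∃[ w ] V w
Advanced V hit (suc w) = V w

Advanced-map : ∀ {V V′ hit hit′} → (∀ {w} → V w → V′ w) → (hit → hit′) →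
               ∀ w → Advanced V hit w → Advanced V′ hit′ w
Advanced-map f h zero    (x , w , v) = h x , w , f v
Advanced-map f h (suc _) v           = f v

-- The child entered by this walk is entered again by the walk after next, so its new countdown `w`
-- reads `suc (w + w)` at the parent.
Advanced-double : ∀ {V V′ hit} → (∀ {w} → V w → V′ (suc (w + w))) →
                  ∀ w → Advanced V hit w → Advanced V′ hit (w + w)
Advanced-double f zero    (x , w , v) = x , _ , f v
Advanced-double {V′ = V′} f (suc w) v = subst V′ (sym (ℕₚ.+-suc w w)) (f v)

-- Just after a cut one day of growth is already counted, and `1 + w ≤ p` is the budget required
-- there.
Visits-< : ∀ {n} {e : Fin n} {T p w} → Visits e T p w → w ℕ.< p
Visits-< here            = s≤s z≤n
Visits-< (left-now v)    = ℕₚ.+-mono-< (Visits-< v) (Visits-< v)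
Visits-< (right-now v)   = ℕₚ.+-mono-< (Visits-< v) (Visits-< v)
Visits-< (left-later v)  = ℕₚ.+-mono-≤-< (Visits-< v) (Visits-< v)
Visits-< (right-later v) = ℕₚ.+-mono-≤-< (Visits-< v) (Visits-< v)

1≤leaves : ∀ {n} (T : Tree n) → 1 ≤ leaves T
1≤leaves (leaf _)     = s≤s z≤n
1≤leaves (node _ l r) = ℕₚ.m≤n⇒m≤n+o (leaves r) (1≤leaves l)

-- The walk visits one vertex per level, and each level it descends leaves a sibling subtree with at
-- least one leaf, so the leaf count bounds the time.
unfuse-triple : ∀ {n} (T : Tree n) → Triple (unfuse T) (leaves T) λ (T′ , x) →
  leaves T′ ≡ leaves T ×
  (∀ {e p w} → Visits e T p w → Advanced (Visits e T′ p) (e ≡ x) w)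
unfuse-triple (leaf e) = spend 1 (ret (refl , λ { here → refl , 0 , here }))
-- The bit is flipped before the move, so `true` sends this walk to the left.
unfuse-triple (node true l r) =
  relax (ℕₚ.≤-trans (ℕₚ.+-mono-≤ (1≤leaves r) (ℕₚ.≤-reflexive (ℕₚ.+-identityʳ _)))
                    (ℕₚ.≤-reflexive (ℕₚ.+-comm (leaves r) (leaves l))))
    (spend 1 (bind (unfuse-triple l) λ _ (same , advance) →
      ret (cong (_+ leaves r) same , λ where
        (left-now {w = w} v) → Advanced-double left-later w (advance v)
        (right-later v)      → right-now v)))
unfuse-triple (node false l r) =
  relax (ℕₚ.+-mono-≤ (1≤leaves l) (ℕₚ.≤-reflexive (ℕₚ.+-identityʳ _)))
    (spend 1 (bind (unfuse-triple r) λ _ (same , advance) →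
      ret (cong (leaves l +_) same , λ where
        (right-now {w = w} v) → Advanced-double right-later w (advance v)
        (left-later v)        → left-now v)))

record DayResult {n} (F F′ : List (Tree n)) (es : List (Fin n)) : Set where
  field
    trees≡   : length F′ ≡ length F
    leaves≡  : sum (map leaves F′) ≡ sum (map leaves F)
    output≡  : length es ≡ length F
    advances : ∀ {e p} w → VisitedIn e F p w → Advanced (VisitedIn e F′ p) (e ∈ˡ es) w
open DayResult

day-triple : ∀ {n} (F : List (Tree n)) →
  Triple (day F) (suc (length F + sum (map leaves F))) λ (F′ , es) → DayResult F F′ es
day-triple [] = spend 1 (ret record { trees≡ = refl ; leaves≡ = refl ; output≡ = refl ; advances = λ _ () })
day-triple (T ∷ F) =
  relax (ℕₚ.≤-reflexive (rearrange (leaves T) (length F) (sum (map leaves F))))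
    (spend 1 (bind (unfuse-triple T) λ _ (same , advance) →
              bind (day-triple F) λ _ result → ret record
      { trees≡   = cong suc (result .trees≡)
      ; leaves≡  = cong₂ _+_ same (result .leaves≡)
      ; output≡  = cong suc (result .output≡)
      ; advances = λ where
          w (here v)  → Advanced-map here here w (advance v)
          w (there v) → Advanced-map there there w (result .advances w v)
      }))
  where
  rearrange : ∀ l m s → 1 + (l + (suc (m + s) + 0)) ≡ suc (suc m + (l + s))
  rearrange = solve-∀

-- Sizes of the sets cut, and heights along a schedule.

length≤leaves : ∀ {n} (F : List (Tree n)) → length F ≤ sum (map leaves F)
length≤leaves []      = z≤n
length≤leaves (T ∷ F) = ℕₚ.+-mono-≤ (1≤leaves T) (length≤leaves F)

∣p∪q∣≤∣p∣+∣q∣ : ∀ {n} (p q : Subset n) → ∣ p ∪ q ∣ ≤ ∣ p ∣ + ∣ q ∣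
∣p∪q∣≤∣p∣+∣q∣ []            []            = z≤n
∣p∪q∣≤∣p∣+∣q∣ (outside ∷ p) (outside ∷ q) = ∣p∪q∣≤∣p∣+∣q∣ p q
∣p∪q∣≤∣p∣+∣q∣ (outside ∷ p) (inside  ∷ q) =
  ℕₚ.≤-trans (s≤s (∣p∪q∣≤∣p∣+∣q∣ p q)) (ℕₚ.≤-reflexive (sym (ℕₚ.+-suc ∣ p ∣ ∣ q ∣)))
∣p∪q∣≤∣p∣+∣q∣ (inside  ∷ p) (outside ∷ q) = s≤s (∣p∪q∣≤∣p∣+∣q∣ p q)
∣p∪q∣≤∣p∣+∣q∣ (inside  ∷ p) (inside  ∷ q) =
  s≤s (ℕₚ.≤-trans (∣p∪q∣≤∣p∣+∣q∣ p q) (ℕₚ.+-monoʳ-≤ ∣ p ∣ (ℕₚ.n≤1+n ∣ q ∣)))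

∣⋃⁅⁆∣≤length : ∀ {n} (es : List (Fin n)) → ∣ ⋃ (map ⁅_⁆ es) ∣ ≤ length es
∣⋃⁅⁆∣≤length {n} []   = ℕₚ.≤-reflexive (∣⊥∣≡0 n)
∣⋃⁅⁆∣≤length (e ∷ es) = ℕₚ.≤-trans (∣p∪q∣≤∣p∣+∣q∣ ⁅ e ⁆ _)
  (ℕₚ.+-mono-≤ (ℕₚ.≤-reflexive (∣⁅x⁆∣≡1 e)) (∣⋃⁅⁆∣≤length es))

∈-⋃⁅⁆ : ∀ {n} {e : Fin n} {es} → e ∈ˡ es → e ∈ ⋃ (map ⁅_⁆ es)
∈-⋃⁅⁆ (here refl)  = x∈p∪q⁺ (inj₁ (x∈⁅x⁆ _))
∈-⋃⁅⁆ (there e∈es) = x∈p∪q⁺ (inj₂ (∈-⋃⁅⁆ e∈es))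

module _ {n} {g : Fin n → ℚ} {e : Fin n} (π : Schedule n) where

  height-cut : ∀ t → e ∈ π t → height g π (suc t) e ≡ g e
  height-cut t e∈π with e ∈? π t
  ... | yes _   = refl
  ... | no  e∉π = ⊥-elim (e∉π e∈π)

  height-grow : ∀ t → ¬ e ∈ π t → height g π (suc t) e ≡ height g π t e ℚ.+ g e
  height-grow t e∉π with e ∈? π t
  ... | yes e∈π = ⊥-elim (e∉π e∈π)
  ... | no  _   = refl

height-zero : ∀ {n} {g : Fin n → ℚ} {e} π → g e ≡ 0ℚ → ∀ t → height g π t e ≡ 0ℚ
height-zero π g≡0 zero = g≡0
height-zero {e = e} π g≡0 (suc t) with e ∈? π t
... | yes _ = g≡0
... | no  _ = cong₂ ℚ._+_ (height-zero π g≡0 t) g≡0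

-- This keeps the statement about all runs from being vacuous.
someRun : ∀ {n} k (g : Fin n → ℚ) → Run k g
someRun {n} k g = record
  { forest   = forestAt
  ; output   = λ t → proj₂ (proj₁ (outcome (day (forestAt t))))
  ; prepTime = proj₁ (proj₂ (outcome (preprocess k g)))
  ; dayTime  = λ t → proj₁ (proj₂ (outcome (day (forestAt t))))
  ; prep     = proj₂ (proj₂ (outcome (preprocess k g)))
  ; days     = λ t → proj₂ (proj₂ (outcome (day (forestAt t))))
  }
  where
  forestAt : ℕ → List (Tree n)
  forestAt zero    = proj₁ (outcome (preprocess k g))
  forestAt (suc t) = proj₁ (proj₁ (outcome (day (forestAt t))))

-- Validity, height and running time of an arbitrary run.

module _ {n k} {g : Fin n → ℚ} (G : IsCBGT (uniformMatroid n k) g) (r : Run k g) where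
  open IsCBGT G using (g-nonNegative)
  open Prepared

  private
    π = schedule r

    prepared : Prepared k g (forest r 0)
    prepared = proj₂ (preprocess-triple G .run (prep r))

    result : ∀ t → DayResult (forest r t) (forest r (suc t)) (output r t)
    result t = proj₂ (day-triple (forest r t) .run (days r t))

    trees≤k : ∀ t → length (forest r t) ≤ k
    trees≤k zero    = prepared .trees≤
    trees≤k (suc t) = subst (_≤ k) (sym (result t .trees≡)) (trees≤k t)

    leaves≤n : ∀ t → sum (map leaves (forest r t)) ≤ n
    leaves≤n zero    = prepared .leaves≤
    leaves≤n (suc t) = subst (_≤ n) (sym (result t .leaves≡)) (leaves≤n t)

    -- The height is c g(e) after c days of growth, and w further days
    -- remain until the cut.
    Tracked : Fin n → ℕ → ℕ → Set
    Tracked e p t = ∃[ c ] ∃[ w ] (height g π t e ≡ c · g e × VisitedIn e (forest r t) p w × c + w ≤ p)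

    restart : ∀ {e p t w} → height g π t e ≡ g e → VisitedIn e (forest r t) p w → Tracked e p t
    restart {e} {w = w} h≡g v =
      1 , w , trans h≡g (sym (ℚₚ.+-identityʳ (g e))) , v , Visits-< (proj₂ (Any.satisfied v))

    track-suc : ∀ {e p} t c w → Dec (e ∈ π t) → height g π t e ≡ c · g e → c + w ≤ p →
                Advanced (VisitedIn e (forest r (suc t)) p) (e ∈ˡ output r t) w → Tracked e p (suc t)
    track-suc t c zero    (yes e∈π) _ _ (_ , _ , v) = restart (height-cut π t e∈π) v
    -- The tracked data leave open a cut before the countdown ends. Such a cut merely restarts the
    -- count, as any countdown is below the period.
    track-suc t c (suc _) (yes e∈π) _ _ v           = restart (height-cut π t e∈π) v
    -- A countdown at 0 forces `e` into the output of the day.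
    track-suc t c zero    (no  e∉π) _ _ (e∈ , _)    = ⊥-elim (e∉π (∈-⋃⁅⁆ e∈))
    track-suc {e} {p} t c (suc w) (no e∉π) h≡ c+w≤p v = suc c , w ,
      trans (height-grow π t e∉π) (trans (ℚₚ.+-comm _ (g e)) (cong (g e ℚ.+_) h≡)) ,
      v , subst (_≤ p) (ℕₚ.+-suc c w) c+w≤p

    track : ∀ {e p w} → VisitedIn e (forest r 0) p w → ∀ t → Tracked e p t
    track v zero = restart refl v
    track {e} v (suc t) =
      let c , w , h≡ , v′ , c+w≤p = track v t in
      track-suc t c w (e ∈? π t) h≡ c+w≤p (result t .advances w v′)

  valid : Valid (uniformMatroid n k) π
  valid t = ℕₚ.≤-trans (∣⋃⁅⁆∣≤length (output r t))
    (subst (_≤ k) (sym (result t .output≡)) (trees≤k t))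

  height≤2 : HeightAtMost g π 2ℚ
  height≤2 e t with g e ℚₚ.≟ 0ℚ
  -- Such a bamboo has no leaf in the initial collection, but its height stays 0.
  ... | yes g≡0 = subst (ℚ._≤ 2ℚ) (sym (height-zero π g≡0 t)) (ℚₚ.nonNegative⁻¹ 2ℚ)
  ... | no  g≢0 =
    let p , w , v , p≤2 = prepared .covering e g≢0
        c , w′ , h≡ , _ , c+w≤p = track v t in
    subst (ℚ._≤ 2ℚ) (sym h≡)
      (ℚₚ.≤-trans (·-monoˡ-≤ (ℕₚ.m+n≤o⇒m≤o c c+w≤p) (g-nonNegative e)) p≤2)

  prepTime≤ : prepTime r ≤ 41 * inputSize n k g ^ 4
  prepTime≤ = proj₁ (preprocess-triple G .run (prep r))

  dayTime≤ : ∀ t → dayTime r t ≤ 41 * inputSize n k g ^ 4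
  dayTime≤ t = begin
    dayTime r t                ≤⟨ proj₁ (day-triple F .run (days r t)) ⟩
    suc (length F + ℓ)         ≤⟨ s≤s (ℕₚ.+-mono-≤ (ℕₚ.≤-trans (length≤leaves F) (leaves≤n t)) (leaves≤n t)) ⟩
    suc (n + n)                ≤⟨ ℕₚ.+-mono-≤ n<N (ℕₚ.<⇒≤ n<N) ⟩
    -- The linear bound is weakened to the polynomial for preprocessing, so that one pair of
    -- constants serves both times.
    N + N                      ≤⟨ ℕₚ.+-monoʳ-≤ N (ℕₚ.m≤m+n N _) ⟩
    N + (N + (suc N * roundBound N N N + (N + 0)))
                               ≤⟨ polynomial-bound N (ℕₚ.≤-trans (s≤s z≤n) n<N) ⟩
    41 * N ^ 4                 ∎
    where
    open ℕₚ.≤-Reasoning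
    F = forest r t
    ℓ = sum (map leaves F)
    N = inputSize n k g
    n<N : n ℕ.< N
    n<N = ℕₚ.≤-trans (s≤s (ℕₚ.m≤m+n n (sum (map (size ∘ g) (allFin n))))) (n+sizes<inputSize n k g)

theorem4p4 : ∃[ c ] ∃[ d ] ((n k : ℕ) (g : Fin n → ℚ) → IsCBGT (uniformMatroid n k) g →
    Run k g ×
    ((r : Run k g) →
    Valid (uniformMatroid n k) (schedule r) ×
    HeightAtMost g (schedule r) 2ℚ ×
    prepTime r ≤ c * inputSize n k g ^ d ×
    (∀ t → dayTime r t ≤ c * inputSize n k g ^ d)))
theorem4p4 = 41 , 4 , λ n k g G →
  someRun k g , λ r → valid G r , height≤2 G r , prepTime≤ G r , dayTime≤ G r
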